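{- Let $E=\{a,b,c,d,e,f,g,h,i,j,k\}$. Let $M_1$ be the rank-$3$ matroid on $E$ whose bases are the $3$-element subsets $B\subseteq E$ with $|B\cap F|\le 2$ for each of the fifteen sets $$\{a,b,k\},\{b,c,e\},\{c,d,i\},\{a,d,f\},\{b,d,h\},\{a,c,j\},\{e,f,i\},\{f,g,c\},\{g,h,j\},\{h,e,a\},\{e,g,d\},\{f,h,k\},\{i,j,b\},\{j,k,e\},\{k,i,g\}.$$ Let $M_2$ be the rank-$3$ matroid on $E$ whose bases are the $3$-element subsets $B\subseteq E$ with $|B\cap\{a,b,c,d\}|\le 1$, $|B\cap\{e,f,g,h\}|\le 1$, $|B\cap\{e,f,g,h,i,j,k\}|\le 2$ and $|B\cap\{i,j\}|\le 1$. Then the pair $(M_1,M_2)$ is a counterexample to Lucas's conjecture: $\mathcal{B}(M_2)\subseteq\mathcal{B}(M_1)$, $M_1$ covers $M_2$ in the weak-map order (there is no matroid $M_3$ on $E$ with $\mathcal{B}(M_2)\subsetneq\mathcal{B}(M_3)\subsetneq\mathcal{B}(M_1)$), the dimension of the base polytope of $M_2$ is smaller than that of $M_1$, and yet the base polytope of $M_2$ is not a facet of the base polytope of $M_1$.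
   Context: $\mathcal{B}(N)$ denotes the set of bases of a matroid $N$; the weak-map order on matroids of the same rank on $E$ is $N\succeq N'$ iff $\mathcal{B}(N')\subseteq\mathcal{B}(N)$. The base polytope is $B(N)=\mathrm{conv}\{\chi_B:B\in\mathcal{B}(N)\}$, of dimension $|E|$ minus the number of connected components of $N$. Lucas's conjecture asserts: if $M_1$ covers $M_2$ in the weak-map order among matroids of rank $r$ on $E$ and $\dim B(M_2)<\dim B(M_1)$, then $B(M_2)$ is a facet of $B(M_1)$.
   Formalization: The base polytopes are taken in rational rather than real space: their points, the convex and affine combinations, and the linear inequalities that define faces all have rational coefficients. -}

module Defs where

open import Data.Nat using (ℕ; zero; suc; _<_)
open import Data.Fin using (Fin; #_)
open import Data.Fin.Subset using (Subset; _∈_; _∉_; _∩_; _∪_; _-_; ⁅_⁆; ∣_∣; ⊥)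
open import Data.Bool using (Bool; true; false; if_then_else_)
open import Data.List using (List; []; _∷_; foldr)
open import Data.List.Relation.Unary.All using (All)
open import Data.Vec using (lookup)
open import Data.Product using (Σ; ∃; ∃-syntax; _×_; _,_)
open import Relation.Nullary using (¬_)
open import Relation.Binary.PropositionalEquality using (_≡_)
open import Data.Rational using (ℚ; 0ℚ; 1ℚ; _+_; _*_; _≤_)
import Data.Nat as ℕ

E : Set
E = Fin 11

𝕒 𝕓 𝕔 𝕕 𝕖 𝕗 𝕘 𝕙 𝕚 𝕛 𝕜 : E
𝕒 = # 0
𝕓 = # 1
𝕔 = # 2
𝕕 = # 3
𝕖 = # 4
𝕗 = # 5
𝕘 = # 6
𝕙 = # 7
𝕚 = # 8
𝕛 = # 9
𝕜 = # 10

set : List E → Subset 11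
set = foldr (λ x s → ⁅ x ⁆ ∪ s) ⊥

Family : Set₁
Family = Subset 11 → Set

IsMatroidBases : Family → ℕ → Set
IsMatroidBases 𝓑 r =
  (∃[ B ] 𝓑 B) ×
  (∀ B → 𝓑 B → ∣ B ∣ ≡ r) ×
  (∀ A B → 𝓑 A → 𝓑 B → ∀ x → x ∈ A → x ∉ B →
     ∃[ y ] (y ∈ B × y ∉ A × 𝓑 ((A - x) ∪ ⁅ y ⁆)))

_⊆ᶠ_ : Family → Family → Set
𝓑 ⊆ᶠ 𝓑' = ∀ B → 𝓑 B → 𝓑' B

_⊊ᶠ_ : Family → Family → Set
𝓑 ⊊ᶠ 𝓑' = (𝓑 ⊆ᶠ 𝓑') × (∃[ B ] (𝓑' B × ¬ 𝓑 B))

Covers : ℕ → Family → Family → Set₁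
Covers r 𝓑₁ 𝓑₂ =
  (𝓑₂ ⊊ᶠ 𝓑₁) ×
  (∀ (𝓑₃ : Family) → IsMatroidBases 𝓑₃ r → ¬ ((𝓑₂ ⊊ᶠ 𝓑₃) × (𝓑₃ ⊊ᶠ 𝓑₁)))

lines₁ : List (Subset 11)
lines₁ =
  set (𝕒 ∷ 𝕓 ∷ 𝕜 ∷ []) ∷ set (𝕓 ∷ 𝕔 ∷ 𝕖 ∷ []) ∷ set (𝕔 ∷ 𝕕 ∷ 𝕚 ∷ []) ∷
  set (𝕒 ∷ 𝕕 ∷ 𝕗 ∷ []) ∷ set (𝕓 ∷ 𝕕 ∷ 𝕙 ∷ []) ∷ set (𝕒 ∷ 𝕔 ∷ 𝕛 ∷ []) ∷
  set (𝕖 ∷ 𝕗 ∷ 𝕚 ∷ []) ∷ set (𝕗 ∷ 𝕘 ∷ 𝕔 ∷ []) ∷ set (𝕘 ∷ 𝕙 ∷ 𝕛 ∷ []) ∷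
  set (𝕙 ∷ 𝕖 ∷ 𝕒 ∷ []) ∷ set (𝕖 ∷ 𝕘 ∷ 𝕕 ∷ []) ∷ set (𝕗 ∷ 𝕙 ∷ 𝕜 ∷ []) ∷
  set (𝕚 ∷ 𝕛 ∷ 𝕓 ∷ []) ∷ set (𝕛 ∷ 𝕜 ∷ 𝕖 ∷ []) ∷ set (𝕜 ∷ 𝕚 ∷ 𝕘 ∷ []) ∷ []

𝓑₁ : Family
𝓑₁ B = (∣ B ∣ ≡ 3) × All (λ F → ∣ B ∩ F ∣ ℕ.≤ 2) lines₁

𝓑₂ : Family
𝓑₂ B =
  (∣ B ∣ ≡ 3) ×
  (∣ B ∩ set (𝕒 ∷ 𝕓 ∷ 𝕔 ∷ 𝕕 ∷ []) ∣ ℕ.≤ 1) ×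
  (∣ B ∩ set (𝕖 ∷ 𝕗 ∷ 𝕘 ∷ 𝕙 ∷ []) ∣ ℕ.≤ 1) ×
  (∣ B ∩ set (𝕖 ∷ 𝕗 ∷ 𝕘 ∷ 𝕙 ∷ 𝕚 ∷ 𝕛 ∷ 𝕜 ∷ []) ∣ ℕ.≤ 2) ×
  (∣ B ∩ set (𝕚 ∷ 𝕛 ∷ []) ∣ ℕ.≤ 1)

Point : Set
Point = E → ℚ

Region : Set₁
Region = Point → Set

sumF : ∀ {m} → (Fin m → ℚ) → ℚ
sumF {zero}  f = 0ℚ
sumF {suc m} f = f Fin.zero + sumF (λ i → f (Fin.suc i))

dot : Point → Point → ℚ
dot w x = sumF (λ e → w e * x e)

χ : Subset 11 → Point
χ B e = if lookup B e then 1ℚ else 0ℚ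

BasePolytope : Family → Region
BasePolytope 𝓑 x =
  ∃[ m ] Σ (Fin m → ℚ) λ c → Σ (Fin m → Subset 11) λ Bs →
    (∀ i → 𝓑 (Bs i)) × (∀ i → 0ℚ ≤ c i) × (sumF c ≡ 1ℚ) ×
    (∀ e → x e ≡ sumF (λ i → c i * χ (Bs i) e))

AffinelyIndependent : ∀ {m} → (Fin m → Point) → Set
AffinelyIndependent {m} p =
  ∀ (l : Fin m → ℚ) → sumF l ≡ 0ℚ →
    (∀ e → sumF (λ i → l i * p i e) ≡ 0ℚ) → ∀ i → l i ≡ 0ℚ

HasDim : Region → ℕ → Set
HasDim P d =
  (Σ (Fin (suc d) → Point) λ p → (∀ i → P (p i)) × AffinelyIndependent p) ×
  (∀ (p : Fin (suc (suc d)) → Point) → (∀ i → P (p i)) → ¬ AffinelyIndependent p)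

IsFace : Region → Region → Set
IsFace F P =
  Σ Point λ w → Σ ℚ λ c →
    (∀ x → P x → dot w x ≤ c) ×
    (∀ x → F x → (P x × dot w x ≡ c)) ×
    (∀ x → P x → dot w x ≡ c → F x)

IsFacet : Region → Region → Set
IsFacet F P = IsFace F P × (∃[ d ] (HasDim P (suc d) × HasDim F d))

{-# OPTIONS --safe #-}
module Submission where

-- The bases of M₂ all satisfy |B ∩ abcd| = 1 besides |B| = 3, which makes B(M₂) one dimension
-- smaller than B(M₁), whose vertices span the whole hyperplane Σ x = 3.  It is not a facet, not even a face:
-- χ aef = χ aei + χ afk - χ aik is a vertex of B(M₁) on the affine hull of B(M₂) but outside B(M₂).
--
-- For the covering relation, let M₂ ≤ M₃ ≤ M₁. If A and B are bases of M₃ and x ∈ A ∖ B, and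
-- there is only one y ∈ B with A - x + y a basis of M₁, then A - x + y is a basis of M₃.
-- Starting from the bases of M₂ and any single further basis, this inference
-- first reaches aij and then all bases of M₁; the lists toHub and fromHub record the steps.

open import Defs
open import Algebra.Bundles using (CommutativeRing)
import Algebra.Definitions.RawMonoid as RawMonoid
import Algebra.Properties.CommutativeMonoid.Sum as CommutativeMonoidSum
import Algebra.Properties.Semiring.Sum as SemiringSum
open import Data.Bool using (Bool; if_then_else_)
import Data.Bool as Bool
import Data.Bool.Properties as Bool
open import Data.Fin using (Fin; zero; suc; punchIn; punchOut)
import Data.Fin as Fin
import Data.Fin.Properties as Fin
open import Data.Fin.Subset
  using (Subset; inside; outside; _∈_; _∉_; _∩_; _∪_; _-_; ⁅_⁆; ∣_∣; ⊤)
open import Data.Fin.Subset.Properties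
  using (_∈?_; x∈⁅x⁆; x∈⁅y⁆⇒x≡y; x∈p∪q⁺; x∈p∪q⁻; x∈p∧x≢y⇒x∈p-y; ∩-identityʳ; ∪-identityʳ; p─⊥≡p)
open import Data.List using (List; []; _∷_; filter; allFin)
import Data.List.Membership.DecPropositional as DecMembership
open import Data.List.Membership.Propositional using (find) renaming (_∈_ to _∈ˡ_)
open import Data.List.Membership.Propositional.Properties using (∈-filter⁺; ∈-filter⁻; ∈-allFin)
open import Data.List.Relation.Unary.All using (All; []; _∷_; all?)
import Data.List.Relation.Unary.All as All
open import Data.List.Relation.Unary.Any using (Any; any?)
open import Data.Nat using (ℕ; zero; suc; _<_)
import Data.Nat as ℕ
import Data.Nat.Properties as ℕ
open import Data.Product using (Σ; ∃-syntax; _×_; _,_; proj₁; proj₂)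
open import Data.Rational using (ℚ; 0ℚ; 1ℚ; _+_; _*_; -_; 1/_; _≤_; ≢-nonZero; nonNegative)
  renaming (_-_ to _-ℚ_)
import Data.Rational.Properties as ℚ
open import Data.Sum using (_⊎_; inj₁; inj₂)
open import Data.Vec using ([]; _∷_; here; there; lookup)
import Data.Vec as Vec
import Data.Vec.Properties as Vec
open import Function using (_∘_)
open import Relation.Binary.PropositionalEquality
open import Relation.Nullary
open import Relation.Nullary.Decidable
  using (map′; from-yes; from-no; _×-dec_; _⊎-dec_; _→-dec_; ¬?; decidable-stable; dec⇒maybe)
open import Relation.Unary using (Decidable)
open import Tactic.RingSolver using (solve-∀)
open import Tactic.RingSolver.Core.AlmostCommutativeRing using (AlmostCommutativeRing; fromCommutativeRing)

open CommutativeRing ℚ.+-*-commutativeRing using (semiring; +-rawMonoid; +-commutativeMonoid)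
open RawMonoid +-rawMonoid using () renaming (_×_ to _×ℚ_)
open CommutativeMonoidSum +-commutativeMonoid using (sum; sum-remove; ∑-distrib-+; ∑-comm)
open SemiringSum semiring using (*-distribˡ-sum)

-- Exchange in M₁ and M₂

_≟ˢ_ : (p q : Subset 11) → Dec (p ≡ q)
_≟ˢ_ = Vec.≡-dec Bool._≟_

open DecMembership _≟ˢ_ using () renaming (_∈?_ to _∈ˡ?_)

-- Branching on the first element with the remaining size as a budget tests `P` on the k-subsets
-- only, not on all subsets, which keeps the exhaustive checks below feasible.
allOfSize? : ∀ n k {P : Subset n → Set} → Decidable P → Dec (∀ p → ∣ p ∣ ≡ k → P p)
allOfSize? zero zero P? = map′ (λ { h [] _ → h }) (λ h → h [] refl) (P? [])
allOfSize? zero (suc k) P? = yes λ { [] () }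
allOfSize? (suc n) zero P? =
  map′ (λ { h (outside ∷ p) eq → h p eq ; h (inside ∷ p) () }) (λ h p → h (outside ∷ p))
    (allOfSize? n zero (P? ∘ (outside ∷_)))
allOfSize? (suc n) (suc k) P? =
  map′ (λ { (h , _) (inside ∷ p) eq → h p (ℕ.suc-injective eq) ; (_ , h) (outside ∷ p) eq → h p eq })
    (λ h → (λ p eq → h (inside ∷ p) (cong suc eq)) , (λ p → h (outside ∷ p)))
    (allOfSize? n k (P? ∘ (inside ∷_)) ×-dec allOfSize? n (suc k) (P? ∘ (outside ∷_)))

x∈p⇒suc∣p-x∣≡∣p∣ : ∀ {n x} {p : Subset n} → x ∈ p → suc ∣ p - x ∣ ≡ ∣ p ∣
x∈p⇒suc∣p-x∣≡∣p∣ {p = inside ∷ p} here = cong (suc ∘ ∣_∣) (p─⊥≡p p)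
x∈p⇒suc∣p-x∣≡∣p∣ {p = inside ∷ p} (there x∈p) = cong suc (x∈p⇒suc∣p-x∣≡∣p∣ x∈p)
x∈p⇒suc∣p-x∣≡∣p∣ {p = outside ∷ p} (there x∈p) = x∈p⇒suc∣p-x∣≡∣p∣ x∈p

x∉p-x : ∀ {n x} (p : Subset n) → x ∉ p - x
x∉p-x {x = suc x} (_ ∷ p) (there x∈) = x∉p-x p x∈

p-x∪⁅x⁆≡p : ∀ {n x} {p : Subset n} → x ∈ p → (p - x) ∪ ⁅ x ⁆ ≡ p
p-x∪⁅x⁆≡p {p = _ ∷ p} here = cong (inside ∷_) (trans (∪-identityʳ _) (p─⊥≡p p))
p-x∪⁅x⁆≡p {p = s ∷ _} (there x∈p) = cong₂ _∷_ (Bool.∨-identityʳ _) (p-x∪⁅x⁆≡p x∈p)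

∈-set⁻ : ∀ {y z r s} → y ∈ set (z ∷ r ∷ s ∷ []) → y ≡ z ⊎ y ≡ r ⊎ y ≡ s
∈-set⁻ {z = z} {r} {s} y∈ with x∈p∪q⁻ ⁅ z ⁆ _ y∈
... | inj₁ y∈z = inj₁ (x∈⁅y⁆⇒x≡y z y∈z)
... | inj₂ y∈rs with x∈p∪q⁻ ⁅ r ⁆ _ y∈rs
...   | inj₁ y∈r = inj₂ (inj₁ (x∈⁅y⁆⇒x≡y r y∈r))
...   | inj₂ y∈s = inj₂ (inj₂ (x∈⁅y⁆⇒x≡y s (subst (_ ∈_) (∪-identityʳ ⁅ s ⁆) y∈s)))

𝓑₁? : Decidable 𝓑₁
𝓑₁? B = (∣ B ∣ ℕ.≟ 3) ×-dec all? (λ F → ∣ B ∩ F ∣ ℕ.≤? 2) lines₁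

𝓑₂? : Decidable 𝓑₂
𝓑₂? B =
  (∣ B ∣ ℕ.≟ 3) ×-dec
  (∣ B ∩ set (𝕒 ∷ 𝕓 ∷ 𝕔 ∷ 𝕕 ∷ []) ∣ ℕ.≤? 1) ×-dec
  (∣ B ∩ set (𝕖 ∷ 𝕗 ∷ 𝕘 ∷ 𝕙 ∷ []) ∣ ℕ.≤? 1) ×-dec
  (∣ B ∩ set (𝕖 ∷ 𝕗 ∷ 𝕘 ∷ 𝕙 ∷ 𝕚 ∷ 𝕛 ∷ 𝕜 ∷ []) ∣ ℕ.≤? 2) ×-dec
  (∣ B ∩ set (𝕚 ∷ 𝕛 ∷ []) ∣ ℕ.≤? 1)

extends? : ∀ {𝓑 : Family} → Decidable 𝓑 → ∀ D → Decidable (λ y → y ∉ D × 𝓑 (D ∪ ⁅ y ⁆))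
extends? 𝓑? D y = ¬? (y ∈? D) ×-dec 𝓑? (D ∪ ⁅ y ⁆)

-- In a rank-3 matroid and for an independent pair D this is the cocircuit complementary to the line
-- spanned by D.
extensions : ∀ {𝓑 : Family} → Decidable 𝓑 → Subset 11 → List E
extensions 𝓑? D = filter (extends? 𝓑? D) (allFin 11)

Meets : Family → List E → Set
Meets 𝓑 ys = ∀ B → ∣ B ∣ ≡ 3 → Any (_∈ B) ys ⊎ ¬ 𝓑 B

-- The list argument is shared over all B, so that the extensions of D are computed once in augmentation?.
meets? : ∀ {𝓑 : Family} → Decidable 𝓑 → Decidable (Meets 𝓑)
meets? 𝓑? ys = allOfSize? 11 3 λ B → any? (_∈? B) ys ⊎-dec ¬? (𝓑? B)

-- The exchange condition depends on A and x only through D = A - x, so it can be tested on pairs D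
-- against bases B. The empty alternative covers the pairs that lie in no basis.
Augmentation : ∀ {𝓑 : Family} → Decidable 𝓑 → Set
Augmentation {𝓑} 𝓑? = ∀ D → ∣ D ∣ ≡ 2 → extensions 𝓑? D ≡ [] ⊎ Meets 𝓑 (extensions 𝓑? D)

augmentation? : ∀ {𝓑 : Family} (𝓑? : Decidable 𝓑) → Dec (Augmentation 𝓑?)
augmentation? 𝓑? = allOfSize? 11 2 λ D → []-or-meets? (extensions 𝓑? D)
  where
  []-or-meets? : ∀ ys → Dec (ys ≡ [] ⊎ Meets _ ys)
  []-or-meets? [] = yes (inj₁ refl)
  []-or-meets? ys@(_ ∷ _) = map′ inj₂ (λ { (inj₂ m) → m }) (meets? 𝓑? ys)

-- Take D = A - x. Since x itself extends D, the list of extensions is not empty, so B contains some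
-- extension y. As x is not in B, y differs from x and hence lies outside A.
augmentation⇒exchange : ∀ {𝓑 : Family} (𝓑? : Decidable 𝓑) → (∀ B → 𝓑 B → ∣ B ∣ ≡ 3) → Augmentation 𝓑? →
  ∀ A B → 𝓑 A → 𝓑 B → ∀ x → x ∈ A → x ∉ B → ∃[ y ] (y ∈ B × y ∉ A × 𝓑 ((A - x) ∪ ⁅ y ⁆))
augmentation⇒exchange {𝓑} 𝓑? size aug A B hA hB x x∈A x∉B
  with aug (A - x) (ℕ.suc-injective (trans (x∈p⇒suc∣p-x∣≡∣p∣ x∈A) (size A hA)))
... | inj₁ ext≡[] = contradiction (subst (x ∈ˡ_) ext≡[] x∈ext) λ ()
  where
  x∈ext : x ∈ˡ extensions 𝓑? (A - x)
  x∈ext = ∈-filter⁺ (extends? 𝓑? (A - x)) (∈-allFin x)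
    (x∉p-x A , subst 𝓑 (sym (p-x∪⁅x⁆≡p x∈A)) hA)
... | inj₂ meets with meets B (size B hB)
...   | inj₂ ¬hB = contradiction hB ¬hB
...   | inj₁ hit =
  let y , y∈ext , y∈B = find hit
      y∉A-x , h = proj₂ (∈-filter⁻ (extends? 𝓑? (A - x)) {xs = allFin 11} y∈ext)
  in y , y∈B , (λ y∈A → y∉A-x (x∈p∧x≢y⇒x∈p-y y∈A λ y≡x → x∉B (subst (_∈ B) y≡x y∈B))) , h

-- Opaque, so that the results of the exhaustive checks are not unfolded where they are used.
abstract
  augmentation₁ : Augmentation 𝓑₁?
  augmentation₁ = from-yes (augmentation? 𝓑₁?)

  augmentation₂ : Augmentation 𝓑₂?
  augmentation₂ = from-yes (augmentation? 𝓑₂?)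

  𝓑₂⊆𝓑₁ : 𝓑₂ ⊆ᶠ 𝓑₁
  𝓑₂⊆𝓑₁ B h = from-yes (allOfSize? 11 3 λ B → 𝓑₂? B →-dec 𝓑₁? B) B (proj₁ h) h

isMatroid₁ : IsMatroidBases 𝓑₁ 3
isMatroid₁ =
  (set (𝕒 ∷ 𝕖 ∷ 𝕚 ∷ []) , from-yes (𝓑₁? (set (𝕒 ∷ 𝕖 ∷ 𝕚 ∷ [])))) , (λ _ → proj₁) ,
  augmentation⇒exchange 𝓑₁? (λ _ → proj₁) augmentation₁

isMatroid₂ : IsMatroidBases 𝓑₂ 3
isMatroid₂ =
  (set (𝕒 ∷ 𝕖 ∷ 𝕚 ∷ []) , from-yes (𝓑₂? (set (𝕒 ∷ 𝕖 ∷ 𝕚 ∷ [])))) , (λ _ → proj₁) ,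
  augmentation⇒exchange 𝓑₂? (λ _ → proj₁) augmentation₂

-- The covering relation

-- One use of the exchange axiom with A = `source`, B = `donor` and x = `removed`. Only the six
-- elements are stored, and the three sets are computed from them.
record Exchange : Set where
  constructor exchange
  field kept₁ kept₂ removed entering other₁ other₂ : E

  kept source donor target : Subset 11
  kept = set (kept₁ ∷ kept₂ ∷ [])
  source = kept ∪ ⁅ removed ⁆
  donor = set (entering ∷ other₁ ∷ other₂ ∷ [])
  target = kept ∪ ⁅ entering ⁆

  -- Among the elements of the donor only the entering one can replace the removed one in M₁
  -- (an other element that is already kept gives a set of size 2).
  Forced : Set
  Forced = source - removed ≡ kept × removed ∉ donor × ¬ 𝓑₁ (kept ∪ ⁅ other₁ ⁆) × ¬ 𝓑₁ (kept ∪ ⁅ other₂ ⁆)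

  forced? : Dec Forced
  forced? = ((source - removed) ≟ˢ kept) ×-dec ¬? (removed ∈? donor) ×-dec
    ¬? (𝓑₁? (kept ∪ ⁅ other₁ ⁆)) ×-dec ¬? (𝓑₁? (kept ∪ ⁅ other₂ ⁆))

  -- The axiom offers some y in the donor. If y were one of the two other elements, the result would
  -- be a basis of M₁, which `Forced` excludes; so y is the entering one.
  forced⇒target : ∀ {𝓑} → IsMatroidBases 𝓑 3 → 𝓑 ⊆ᶠ 𝓑₁ → Forced → 𝓑 source → 𝓑 donor → 𝓑 target
  forced⇒target {𝓑} (_ , _ , exch) 𝓑⊆𝓑₁ (source-removed , removed∉ , ¬other₁ , ¬other₂) hs hd
    with exch source donor hs hd removed (x∈p∪q⁺ (inj₂ (x∈⁅x⁆ removed))) removed∉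
  ... | y , y∈donor , _ , h with subst (λ D → 𝓑 (D ∪ ⁅ y ⁆)) source-removed h | ∈-set⁻ y∈donor
  ...   | h′ | inj₁ refl        = h′
  ...   | h′ | inj₂ (inj₁ refl) = contradiction (𝓑⊆𝓑₁ _ h′) ¬other₁
  ...   | h′ | inj₂ (inj₂ refl) = contradiction (𝓑⊆𝓑₁ _ h′) ¬other₂

open Exchange

Exhausts : List (Subset 11) → Set
Exhausts K = ∀ B → ∣ B ∣ ≡ 3 → 𝓑₁ B → 𝓑₂ B ⊎ B ∈ˡ K

exhausts? : Decidable Exhausts
exhausts? K = allOfSize? 11 3 λ B → 𝓑₁? B →-dec (𝓑₂? B ⊎-dec (B ∈ˡ? K))

-- Forward chaining: `K` holds the sets already derived, and each step may draw on them and on M₂.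
Generates : List (Subset 11) → List Exchange → Set
Generates K [] = Exhausts K
Generates K (s ∷ ss) =
  Forced s × (𝓑₂ (source s) ⊎ source s ∈ˡ K) × (𝓑₂ (donor s) ⊎ donor s ∈ˡ K) × Generates (target s ∷ K) ss

generates? : ∀ K ss → Dec (Generates K ss)
generates? K [] = exhausts? K
generates? K (s ∷ ss) =
  forced? s ×-dec (𝓑₂? (source s) ⊎-dec (source s ∈ˡ? K)) ×-dec (𝓑₂? (donor s) ⊎-dec (donor s ∈ˡ? K)) ×-dec
  generates? (target s ∷ K) ss

-- Backward chaining: `K` holds the sets from which the goal follows. One of source and donor must
-- come from M₂, since only a single further basis is assumed; the other one joins `K`.
LeadTo : List (Subset 11) → List Exchange → Set
LeadTo K [] = Exhausts K
LeadTo K (s ∷ ss) =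
  Forced s × target s ∈ˡ K × (𝓑₂ (donor s) × LeadTo (source s ∷ K) ss ⊎ 𝓑₂ (source s) × LeadTo (donor s ∷ K) ss)

leadTo? : ∀ K ss → Dec (LeadTo K ss)
leadTo? K [] = exhausts? K
leadTo? K (s ∷ ss) =
  forced? s ×-dec (target s ∈ˡ? K) ×-dec
  (𝓑₂? (donor s) ×-dec leadTo? (source s ∷ K) ss ⊎-dec 𝓑₂? (source s) ×-dec leadTo? (donor s ∷ K) ss)

module _ {𝓑} (isMatroid : IsMatroidBases 𝓑 3) (𝓑₂⊆𝓑 : 𝓑₂ ⊆ᶠ 𝓑) (𝓑⊆𝓑₁ : 𝓑 ⊆ᶠ 𝓑₁) where

  generates⇒𝓑₁⊆𝓑 : ∀ {K} ss → Generates K ss → All 𝓑 K → 𝓑₁ ⊆ᶠ 𝓑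
  generates⇒𝓑₁⊆𝓑 [] exhausts K⊆𝓑 B hB with exhausts B (proj₁ hB) hB
  ... | inj₁ h = 𝓑₂⊆𝓑 B h
  ... | inj₂ B∈K = All.lookup K⊆𝓑 B∈K
  generates⇒𝓑₁⊆𝓑 {K} (s ∷ ss) (forced , hs , hd , rest) K⊆𝓑 =
    generates⇒𝓑₁⊆𝓑 ss rest (forced⇒target s isMatroid 𝓑⊆𝓑₁ forced (known hs) (known hd) ∷ K⊆𝓑)
    where
    known : ∀ {B} → 𝓑₂ B ⊎ B ∈ˡ K → 𝓑 B
    known (inj₁ h) = 𝓑₂⊆𝓑 _ h
    known (inj₂ B∈K) = All.lookup K⊆𝓑 B∈K

  -- The invariant is a list of implications into `𝓑 H`, and each step composes one of them with
  -- `forced⇒target`. At the end `K` contains every basis of M₁ that is not one of M₂.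
  leadTo⇒ : ∀ {K H} ss → LeadTo K ss → All (λ B → 𝓑 B → 𝓑 H) K → ∀ B → 𝓑 B → ¬ 𝓑₂ B → 𝓑 H
  leadTo⇒ [] exhausts K⇒H B hB ¬h with exhausts B (proj₁ (𝓑⊆𝓑₁ B hB)) (𝓑⊆𝓑₁ B hB)
  ... | inj₁ h = contradiction h ¬h
  ... | inj₂ B∈K = All.lookup K⇒H B∈K hB
  leadTo⇒ (s ∷ ss) (forced , t∈K , inj₁ (hd , rest)) K⇒H =
    leadTo⇒ ss rest
      ((λ hs → All.lookup K⇒H t∈K (forced⇒target s isMatroid 𝓑⊆𝓑₁ forced hs (𝓑₂⊆𝓑 _ hd))) ∷ K⇒H)
  leadTo⇒ (s ∷ ss) (forced , t∈K , inj₂ (hs , rest)) K⇒H =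
    leadTo⇒ ss rest
      ((λ hd → All.lookup K⇒H t∈K (forced⇒target s isMatroid 𝓑⊆𝓑₁ forced (𝓑₂⊆𝓑 _ hs) hd)) ∷ K⇒H)

-- Violates only the last condition of M₂, where i and j are parallel. Passing through one common
-- basis replaces a separate closure computation for each possible further basis.
hub : Subset 11
hub = set (𝕒 ∷ 𝕚 ∷ 𝕛 ∷ [])

-- M₁ has 165 - 15 = 150 bases and M₂ has 4 * 14 = 56. Of the 94 further bases each one except the
-- hub is added by exactly one of the 93 steps. The list runs backwards, starting with the steps
-- whose target is the hub.
toHub : List Exchange
toHub =
  exchange 𝕒 𝕛 𝕖 𝕚 𝕒 𝕔 ∷ exchange 𝕒 𝕛 𝕖 𝕚 𝕔 𝕛 ∷ exchange 𝕔 𝕚 𝕖 𝕒 𝕔 𝕕 ∷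
  exchange 𝕔 𝕚 𝕖 𝕒 𝕕 𝕚 ∷ exchange 𝕔 𝕚 𝕖 𝕛 𝕔 𝕕 ∷ exchange 𝕔 𝕚 𝕖 𝕛 𝕕 𝕚 ∷
  exchange 𝕒 𝕕 𝕓 𝕚 𝕒 𝕗 ∷ exchange 𝕒 𝕕 𝕖 𝕚 𝕒 𝕗 ∷ exchange 𝕒 𝕕 𝕘 𝕚 𝕒 𝕗 ∷
  exchange 𝕒 𝕕 𝕙 𝕚 𝕒 𝕗 ∷ exchange 𝕒 𝕕 𝕛 𝕚 𝕒 𝕗 ∷ exchange 𝕒 𝕕 𝕜 𝕚 𝕒 𝕗 ∷
  exchange 𝕕 𝕖 𝕚 𝕒 𝕖 𝕘 ∷ exchange 𝕒 𝕖 𝕚 𝕕 𝕖 𝕙 ∷ exchange 𝕕 𝕙 𝕚 𝕒 𝕓 𝕙 ∷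
  exchange 𝕒 𝕜 𝕖 𝕕 𝕓 𝕜 ∷ exchange 𝕒 𝕖 𝕚 𝕘 𝕒 𝕙 ∷ exchange 𝕒 𝕖 𝕚 𝕘 𝕖 𝕙 ∷
  exchange 𝕕 𝕙 𝕚 𝕖 𝕓 𝕕 ∷ exchange 𝕕 𝕙 𝕚 𝕖 𝕓 𝕙 ∷ exchange 𝕕 𝕖 𝕚 𝕙 𝕕 𝕘 ∷
  exchange 𝕒 𝕓 𝕔 𝕙 𝕒 𝕜 ∷ exchange 𝕒 𝕙 𝕚 𝕓 𝕒 𝕖 ∷ exchange 𝕒 𝕓 𝕗 𝕙 𝕒 𝕜 ∷
  exchange 𝕒 𝕓 𝕘 𝕙 𝕒 𝕜 ∷ exchange 𝕒 𝕓 𝕚 𝕙 𝕒 𝕜 ∷ exchange 𝕒 𝕓 𝕛 𝕙 𝕒 𝕜 ∷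
  exchange 𝕓 𝕕 𝕔 𝕜 𝕓 𝕙 ∷ exchange 𝕓 𝕕 𝕗 𝕜 𝕓 𝕙 ∷ exchange 𝕓 𝕕 𝕘 𝕜 𝕓 𝕙 ∷
  exchange 𝕓 𝕕 𝕚 𝕜 𝕓 𝕙 ∷ exchange 𝕓 𝕕 𝕛 𝕜 𝕓 𝕙 ∷ exchange 𝕘 𝕙 𝕓 𝕒 𝕘 𝕛 ∷
  exchange 𝕘 𝕙 𝕔 𝕒 𝕘 𝕛 ∷ exchange 𝕘 𝕙 𝕗 𝕒 𝕘 𝕛 ∷ exchange 𝕘 𝕙 𝕚 𝕒 𝕘 𝕛 ∷
  exchange 𝕘 𝕙 𝕜 𝕒 𝕘 𝕛 ∷ exchange 𝕕 𝕖 𝕚 𝕓 𝕖 𝕘 ∷ exchange 𝕓 𝕖 𝕚 𝕕 𝕔 𝕖 ∷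
  exchange 𝕓 𝕖 𝕚 𝕙 𝕓 𝕔 ∷ exchange 𝕓 𝕖 𝕚 𝕙 𝕔 𝕖 ∷ exchange 𝕓 𝕖 𝕚 𝕒 𝕔 𝕖 ∷
  exchange 𝕒 𝕛 𝕖 𝕓 𝕔 𝕛 ∷ exchange 𝕕 𝕚 𝕖 𝕓 𝕔 𝕚 ∷ exchange 𝕔 𝕘 𝕚 𝕙 𝕔 𝕗 ∷
  exchange 𝕘 𝕚 𝕒 𝕙 𝕚 𝕜 ∷ exchange 𝕙 𝕜 𝕒 𝕘 𝕗 𝕜 ∷ exchange 𝕓 𝕖 𝕚 𝕘 𝕓 𝕔 ∷
  exchange 𝕓 𝕖 𝕚 𝕘 𝕔 𝕖 ∷ exchange 𝕔 𝕕 𝕗 𝕖 𝕔 𝕚 ∷ exchange 𝕔 𝕕 𝕘 𝕖 𝕔 𝕚 ∷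
  exchange 𝕔 𝕕 𝕙 𝕖 𝕔 𝕚 ∷ exchange 𝕔 𝕕 𝕜 𝕖 𝕔 𝕚 ∷ exchange 𝕒 𝕔 𝕗 𝕖 𝕒 𝕛 ∷
  exchange 𝕒 𝕔 𝕘 𝕖 𝕒 𝕛 ∷ exchange 𝕒 𝕖 𝕚 𝕔 𝕒 𝕙 ∷ exchange 𝕒 𝕔 𝕜 𝕖 𝕒 𝕛 ∷
  exchange 𝕓 𝕔 𝕗 𝕛 𝕓 𝕖 ∷ exchange 𝕓 𝕔 𝕜 𝕛 𝕓 𝕖 ∷ exchange 𝕗 𝕙 𝕒 𝕔 𝕗 𝕜 ∷
  exchange 𝕗 𝕙 𝕓 𝕔 𝕗 𝕜 ∷ exchange 𝕗 𝕙 𝕕 𝕔 𝕗 𝕜 ∷ exchange 𝕗 𝕙 𝕖 𝕔 𝕗 𝕜 ∷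
  exchange 𝕗 𝕙 𝕚 𝕔 𝕗 𝕜 ∷ exchange 𝕗 𝕙 𝕛 𝕔 𝕗 𝕜 ∷ exchange 𝕙 𝕜 𝕒 𝕚 𝕗 𝕜 ∷
  exchange 𝕗 𝕘 𝕒 𝕜 𝕔 𝕗 ∷ exchange 𝕗 𝕘 𝕓 𝕜 𝕔 𝕗 ∷ exchange 𝕗 𝕘 𝕕 𝕜 𝕔 𝕗 ∷
  exchange 𝕗 𝕘 𝕖 𝕜 𝕔 𝕗 ∷ exchange 𝕘 𝕜 𝕒 𝕗 𝕘 𝕚 ∷ exchange 𝕗 𝕘 𝕛 𝕜 𝕔 𝕗 ∷
  exchange 𝕔 𝕘 𝕚 𝕖 𝕔 𝕗 ∷ exchange 𝕒 𝕙 𝕚 𝕗 𝕒 𝕖 ∷ exchange 𝕗 𝕚 𝕒 𝕙 𝕖 𝕚 ∷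
  exchange 𝕗 𝕚 𝕒 𝕜 𝕖 𝕗 ∷ exchange 𝕗 𝕚 𝕒 𝕜 𝕖 𝕚 ∷ exchange 𝕕 𝕘 𝕚 𝕗 𝕕 𝕖 ∷
  exchange 𝕗 𝕚 𝕒 𝕘 𝕖 𝕚 ∷ exchange 𝕖 𝕗 𝕓 𝕔 𝕖 𝕚 ∷ exchange 𝕖 𝕗 𝕛 𝕔 𝕖 𝕚 ∷
  exchange 𝕖 𝕙 𝕛 𝕚 𝕒 𝕖 ∷ exchange 𝕖 𝕙 𝕜 𝕚 𝕒 𝕖 ∷ exchange 𝕖 𝕜 𝕒 𝕗 𝕛 𝕜 ∷
  exchange 𝕚 𝕜 𝕒 𝕖 𝕘 𝕜 ∷ exchange 𝕖 𝕜 𝕒 𝕚 𝕖 𝕛 ∷ exchange 𝕖 𝕜 𝕒 𝕚 𝕛 𝕜 ∷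
  exchange 𝕖 𝕘 𝕛 𝕚 𝕕 𝕖 ∷ exchange 𝕖 𝕛 𝕒 𝕙 𝕛 𝕜 ∷ exchange 𝕖 𝕜 𝕒 𝕘 𝕛 𝕜 ∷
  exchange 𝕖 𝕚 𝕒 𝕛 𝕗 𝕚 ∷ exchange 𝕚 𝕛 𝕘 𝕖 𝕓 𝕚 ∷ exchange 𝕚 𝕛 𝕙 𝕖 𝕓 𝕚 ∷
  []

-- Again 93 steps, now in order of derivation: each target is one of the further bases other than
-- the hub.
fromHub : List Exchange
fromHub =
  exchange 𝕚 𝕛 𝕒 𝕖 𝕓 𝕚 ∷ exchange 𝕓 𝕚 𝕖 𝕒 𝕚 𝕛 ∷ exchange 𝕓 𝕛 𝕖 𝕒 𝕚 𝕛 ∷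
  exchange 𝕚 𝕛 𝕒 𝕗 𝕓 𝕚 ∷ exchange 𝕚 𝕛 𝕒 𝕘 𝕓 𝕚 ∷ exchange 𝕚 𝕛 𝕒 𝕙 𝕓 𝕚 ∷
  exchange 𝕚 𝕛 𝕒 𝕜 𝕓 𝕚 ∷ exchange 𝕔 𝕛 𝕖 𝕚 𝕒 𝕛 ∷ exchange 𝕖 𝕜 𝕒 𝕚 𝕖 𝕛 ∷
  exchange 𝕒 𝕓 𝕚 𝕖 𝕒 𝕜 ∷ exchange 𝕒 𝕓 𝕚 𝕗 𝕒 𝕜 ∷ exchange 𝕒 𝕓 𝕚 𝕘 𝕒 𝕜 ∷
  exchange 𝕒 𝕓 𝕚 𝕙 𝕒 𝕜 ∷ exchange 𝕔 𝕛 𝕖 𝕓 𝕒 𝕛 ∷ exchange 𝕘 𝕜 𝕒 𝕛 𝕘 𝕚 ∷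
  exchange 𝕓 𝕚 𝕖 𝕔 𝕚 𝕛 ∷ exchange 𝕕 𝕚 𝕖 𝕛 𝕔 𝕚 ∷ exchange 𝕗 𝕚 𝕒 𝕜 𝕖 𝕚 ∷
  exchange 𝕘 𝕚 𝕒 𝕖 𝕚 𝕜 ∷ exchange 𝕘 𝕜 𝕒 𝕖 𝕚 𝕜 ∷ exchange 𝕔 𝕖 𝕚 𝕒 𝕓 𝕖 ∷
  exchange 𝕕 𝕗 𝕚 𝕓 𝕒 𝕗 ∷ exchange 𝕕 𝕙 𝕚 𝕒 𝕓 𝕙 ∷ exchange 𝕓 𝕔 𝕛 𝕜 𝕓 𝕖 ∷
  exchange 𝕖 𝕛 𝕒 𝕘 𝕛 𝕜 ∷ exchange 𝕙 𝕛 𝕒 𝕜 𝕘 𝕛 ∷ exchange 𝕕 𝕚 𝕖 𝕓 𝕔 𝕚 ∷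
  exchange 𝕓 𝕛 𝕖 𝕕 𝕚 𝕛 ∷ exchange 𝕘 𝕚 𝕒 𝕗 𝕚 𝕜 ∷ exchange 𝕘 𝕜 𝕒 𝕗 𝕚 𝕜 ∷
  exchange 𝕙 𝕜 𝕒 𝕚 𝕗 𝕜 ∷ exchange 𝕒 𝕔 𝕖 𝕗 𝕒 𝕛 ∷ exchange 𝕒 𝕔 𝕖 𝕘 𝕒 𝕛 ∷
  exchange 𝕒 𝕙 𝕚 𝕔 𝕒 𝕖 ∷ exchange 𝕒 𝕔 𝕖 𝕜 𝕒 𝕛 ∷ exchange 𝕓 𝕙 𝕚 𝕗 𝕓 𝕕 ∷
  exchange 𝕓 𝕕 𝕗 𝕜 𝕓 𝕙 ∷ exchange 𝕕 𝕙 𝕚 𝕗 𝕓 𝕕 ∷ exchange 𝕒 𝕖 𝕚 𝕕 𝕒 𝕙 ∷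
  exchange 𝕒 𝕕 𝕙 𝕚 𝕒 𝕗 ∷ exchange 𝕒 𝕗 𝕚 𝕙 𝕒 𝕕 ∷ exchange 𝕒 𝕕 𝕙 𝕛 𝕒 𝕗 ∷
  exchange 𝕒 𝕕 𝕙 𝕜 𝕒 𝕗 ∷ exchange 𝕙 𝕛 𝕒 𝕖 𝕘 𝕛 ∷ exchange 𝕖 𝕜 𝕒 𝕙 𝕛 𝕜 ∷
  exchange 𝕗 𝕜 𝕒 𝕛 𝕙 𝕜 ∷ exchange 𝕗 𝕘 𝕚 𝕛 𝕔 𝕗 ∷ exchange 𝕙 𝕜 𝕒 𝕘 𝕗 𝕜 ∷
  exchange 𝕘 𝕚 𝕒 𝕙 𝕚 𝕜 ∷ exchange 𝕕 𝕗 𝕚 𝕔 𝕒 𝕗 ∷ exchange 𝕗 𝕙 𝕓 𝕔 𝕗 𝕜 ∷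
  exchange 𝕒 𝕗 𝕚 𝕖 𝕒 𝕕 ∷ exchange 𝕕 𝕗 𝕚 𝕖 𝕒 𝕕 ∷ exchange 𝕕 𝕘 𝕚 𝕒 𝕕 𝕖 ∷
  exchange 𝕔 𝕚 𝕖 𝕒 𝕕 𝕚 ∷ exchange 𝕔 𝕛 𝕖 𝕕 𝕒 𝕛 ∷ exchange 𝕖 𝕙 𝕛 𝕚 𝕒 𝕖 ∷
  exchange 𝕗 𝕜 𝕒 𝕖 𝕙 𝕜 ∷ exchange 𝕖 𝕛 𝕒 𝕗 𝕛 𝕜 ∷ exchange 𝕙 𝕛 𝕒 𝕗 𝕘 𝕛 ∷
  exchange 𝕘 𝕙 𝕜 𝕒 𝕘 𝕛 ∷ exchange 𝕘 𝕙 𝕜 𝕓 𝕘 𝕛 ∷ exchange 𝕘 𝕙 𝕜 𝕔 𝕘 𝕛 ∷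
  exchange 𝕘 𝕙 𝕜 𝕕 𝕘 𝕛 ∷ exchange 𝕔 𝕕 𝕗 𝕖 𝕔 𝕚 ∷ exchange 𝕔 𝕕 𝕗 𝕘 𝕔 𝕚 ∷
  exchange 𝕔 𝕕 𝕗 𝕙 𝕔 𝕚 ∷ exchange 𝕔 𝕕 𝕗 𝕜 𝕔 𝕚 ∷ exchange 𝕖 𝕗 𝕒 𝕓 𝕖 𝕚 ∷
  exchange 𝕖 𝕗 𝕒 𝕔 𝕖 𝕚 ∷ exchange 𝕕 𝕘 𝕚 𝕗 𝕕 𝕖 ∷ exchange 𝕒 𝕗 𝕚 𝕘 𝕒 𝕕 ∷
  exchange 𝕗 𝕚 𝕒 𝕙 𝕖 𝕚 ∷ exchange 𝕒 𝕖 𝕚 𝕘 𝕒 𝕙 ∷ exchange 𝕕 𝕖 𝕚 𝕙 𝕕 𝕘 ∷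
  exchange 𝕓 𝕖 𝕚 𝕕 𝕔 𝕖 ∷ exchange 𝕓 𝕙 𝕚 𝕔 𝕕 𝕙 ∷ exchange 𝕔 𝕘 𝕚 𝕖 𝕔 𝕗 ∷
  exchange 𝕓 𝕙 𝕚 𝕖 𝕕 𝕙 ∷ exchange 𝕕 𝕘 𝕚 𝕓 𝕕 𝕖 ∷ exchange 𝕔 𝕖 𝕚 𝕙 𝕓 𝕔 ∷
  exchange 𝕓 𝕖 𝕚 𝕘 𝕔 𝕖 ∷ exchange 𝕒 𝕓 𝕚 𝕔 𝕓 𝕜 ∷ exchange 𝕒 𝕓 𝕚 𝕕 𝕓 𝕜 ∷
  exchange 𝕓 𝕔 𝕛 𝕕 𝕔 𝕖 ∷ exchange 𝕓 𝕔 𝕛 𝕗 𝕓 𝕖 ∷ exchange 𝕓 𝕔 𝕛 𝕘 𝕔 𝕖 ∷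
  exchange 𝕖 𝕗 𝕒 𝕘 𝕖 𝕚 ∷ exchange 𝕖 𝕘 𝕚 𝕙 𝕕 𝕘 ∷ exchange 𝕒 𝕔 𝕖 𝕕 𝕒 𝕛 ∷
  exchange 𝕗 𝕘 𝕚 𝕙 𝕔 𝕗 ∷ exchange 𝕗 𝕘 𝕚 𝕓 𝕔 𝕗 ∷ exchange 𝕗 𝕙 𝕓 𝕖 𝕙 𝕜 ∷
  []

abstract
  leadTo-hub : LeadTo (hub ∷ []) toHub
  leadTo-hub = from-yes (leadTo? (hub ∷ []) toHub)

  hub-generates : Generates (hub ∷ []) fromHub
  hub-generates = from-yes (generates? (hub ∷ []) fromHub)

𝓑₁-covers-𝓑₂ : Covers 3 𝓑₁ 𝓑₂
𝓑₁-covers-𝓑₂ =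
  (𝓑₂⊆𝓑₁ , hub , from-yes (𝓑₁? hub) , from-no (𝓑₂? hub)) ,
  λ 𝓑₃ isMatroid₃ ((𝓑₂⊆𝓑₃ , B , hB , ¬hB) , (𝓑₃⊆𝓑₁ , C , hC , ¬hC)) →
    let 𝓑₃-hub = leadTo⇒ isMatroid₃ 𝓑₂⊆𝓑₃ 𝓑₃⊆𝓑₁ toHub leadTo-hub ((λ h → h) ∷ []) B hB ¬hB
    in ¬hC (generates⇒𝓑₁⊆𝓑 isMatroid₃ 𝓑₂⊆𝓑₃ 𝓑₃⊆𝓑₁ fromHub hub-generates (𝓑₃-hub ∷ []) C hC)

-- Finite sums and linear algebra over ℚ

ℚ-ring : AlmostCommutativeRing _ _
ℚ-ring = fromCommutativeRing ℚ.+-*-commutativeRing λ x → dec⇒maybe (0ℚ ℚ.≟ x)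

sumF≡sum : ∀ {m} (f : Fin m → ℚ) → sumF f ≡ sum f
sumF≡sum {zero} f = refl
sumF≡sum {suc m} f = cong (f zero +_) (sumF≡sum (f ∘ suc))

sumF-cong : ∀ {m} {f g : Fin m → ℚ} → (∀ i → f i ≡ g i) → sumF f ≡ sumF g
sumF-cong {zero} f≗g = refl
sumF-cong {suc m} f≗g = cong₂ _+_ (f≗g zero) (sumF-cong (f≗g ∘ suc))

sumF-mono-≤ : ∀ {m} {f g : Fin m → ℚ} → (∀ i → f i ≤ g i) → sumF f ≤ sumF g
sumF-mono-≤ {zero} f≤g = ℚ.≤-refl
sumF-mono-≤ {suc m} f≤g = ℚ.+-mono-≤ (f≤g zero) (sumF-mono-≤ (f≤g ∘ suc))

sumF-zero : ∀ {m} {f : Fin m → ℚ} → (∀ i → f i ≡ 0ℚ) → sumF f ≡ 0ℚ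
sumF-zero {zero} f≗0 = refl
sumF-zero {suc m} f≗0 = cong₂ _+_ (f≗0 zero) (sumF-zero (f≗0 ∘ suc))

sumF-distrib-+ : ∀ {m} (f g : Fin m → ℚ) → sumF (λ i → f i + g i) ≡ sumF f + sumF g
sumF-distrib-+ f g = begin
  sumF (λ i → f i + g i) ≡⟨ sumF≡sum (λ i → f i + g i) ⟩
  sum (λ i → f i + g i)  ≡⟨ ∑-distrib-+ f g ⟩
  sum f + sum g          ≡⟨ cong₂ _+_ (sumF≡sum f) (sumF≡sum g) ⟨
  sumF f + sumF g        ∎
  where open ≡-Reasoning

*-distribˡ-sumF : ∀ {m} x (f : Fin m → ℚ) → x * sumF f ≡ sumF (λ i → x * f i)
*-distribˡ-sumF x f = begin
  x * sumF f           ≡⟨ cong (x *_) (sumF≡sum f) ⟩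
  x * sum f            ≡⟨ *-distribˡ-sum x f ⟩
  sum (λ i → x * f i)  ≡⟨ sumF≡sum (λ i → x * f i) ⟨
  sumF (λ i → x * f i) ∎
  where open ≡-Reasoning

*-distribʳ-sumF : ∀ {m} x (f : Fin m → ℚ) → sumF f * x ≡ sumF (λ i → f i * x)
*-distribʳ-sumF x f = trans (ℚ.*-comm (sumF f) x)
  (trans (*-distribˡ-sumF x f) (sumF-cong λ i → ℚ.*-comm x (f i)))

sumF-comm : ∀ {m n} (f : Fin m → Fin n → ℚ) →
  sumF (λ i → sumF (λ j → f i j)) ≡ sumF (λ j → sumF (λ i → f i j))
sumF-comm f = begin
  sumF (λ i → sumF (f i))           ≡⟨ sumF-cong (sumF≡sum ∘ f) ⟩
  sumF (λ i → sum (f i))            ≡⟨ sumF≡sum (λ i → sum (f i)) ⟩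
  sum (λ i → sum (f i))             ≡⟨ ∑-comm f ⟩
  sum (λ j → sum (λ i → f i j))     ≡⟨ sumF≡sum (λ j → sum (λ i → f i j)) ⟨
  sumF (λ j → sum (λ i → f i j))    ≡⟨ sumF-cong (λ j → sumF≡sum (λ i → f i j)) ⟨
  sumF (λ j → sumF (λ i → f i j))   ∎
  where open ≡-Reasoning

sumF-remove : ∀ {m} (i : Fin (suc m)) (f : Fin (suc m) → ℚ) → sumF f ≡ f i + sumF (f ∘ punchIn i)
sumF-remove i f = begin
  sumF f                       ≡⟨ sumF≡sum f ⟩
  sum f                        ≡⟨ sum-remove {i = i} f ⟩
  f i + sum (f ∘ punchIn i)    ≡⟨ cong (f i +_) (sumF≡sum (f ∘ punchIn i)) ⟨
  f i + sumF (f ∘ punchIn i)   ∎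
  where open ≡-Reasoning

p*q≡0∧q≢0⇒p≡0 : ∀ p {q} → p * q ≡ 0ℚ → q ≢ 0ℚ → p ≡ 0ℚ
p*q≡0∧q≢0⇒p≡0 p {q} pq≡0 q≢0 = begin
  p               ≡⟨ ℚ.*-identityʳ p ⟨
  p * 1ℚ          ≡⟨ cong (p *_) (ℚ.*-inverseʳ q) ⟨
  p * (q * 1/ q)  ≡⟨ ℚ.*-assoc p q (1/ q) ⟨
  p * q * 1/ q    ≡⟨ cong (_* 1/ q) pq≡0 ⟩
  0ℚ * 1/ q       ≡⟨ ℚ.*-zeroˡ (1/ q) ⟩
  0ℚ              ∎
  where
  open ≡-Reasoning
  instance _ = ≢-nonZero q≢0

-- Gaussian elimination on the first coordinate, cleared of denominators.
linearlyDependent : ∀ n (v : Fin (suc n) → Fin n → ℚ) →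
  Σ (Fin (suc n) → ℚ) λ l → (∃[ i ] l i ≢ 0ℚ) × (∀ e → sumF (λ i → l i * v i e) ≡ 0ℚ)
linearlyDependent zero v = (λ _ → 1ℚ) , (zero , λ ()) , λ ()
linearlyDependent (suc n) v with Fin.any? (λ i → ¬? (v i zero ℚ.≟ 0ℚ))
-- The first coordinate vanishes on all vectors, so one vector may get coefficient 0 and the tails
-- of the others have a relation by induction.
... | no ¬pivot = l′ , (suc (proj₁ l≢0) , proj₂ l≢0) , relation
  where
  tails = linearlyDependent n (λ i e → v (suc i) (suc e))
  l = proj₁ tails
  l≢0 = proj₁ (proj₂ tails)

  l′ : Fin (suc (suc n)) → ℚ
  l′ zero = 0ℚ
  l′ (suc i) = l i

  relation : ∀ e → sumF (λ i → l′ i * v i e) ≡ 0ℚ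
  relation zero = sumF-zero λ i →
    trans (cong (l′ i *_) (decidable-stable (v i zero ℚ.≟ 0ℚ) (λ v≢0 → ¬pivot (i , v≢0)))) (ℚ.*-zeroʳ (l′ i))
  relation (suc e) = cong₂ _+_ (ℚ.*-zeroˡ (v zero (suc e))) (proj₂ (proj₂ tails) e)
... | yes (i , vᵢ≢0) = l′ , (punchIn i j , l′≢0) , relation
  where
  a = v i zero
  u : Fin (suc n) → Fin (suc n) → ℚ
  u j = v (punchIn i j)
  eliminated = linearlyDependent n (λ j e → a * u j (suc e) -ℚ u j zero * v i (suc e))
  l = proj₁ eliminated
  j = proj₁ (proj₁ (proj₂ eliminated))

  -- The other vectors get the coefficients `l j * a`; with `- s` at the pivot the first coordinates
  -- cancel as - s * a + s * a.
  s = sumF (λ j → l j * u j zero)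

  l′ : Fin (suc (suc n)) → ℚ
  l′ k with i Fin.≟ k
  ... | yes _ = - s
  ... | no i≢k = l (punchOut i≢k) * a

  l′-pivot : l′ i ≡ - s
  l′-pivot with i Fin.≟ i
  ... | yes _ = refl
  ... | no i≢i = contradiction refl i≢i

  l′-punchIn : ∀ j → l′ (punchIn i j) ≡ l j * a
  l′-punchIn j with i Fin.≟ punchIn i j
  ... | yes i≡ = contradiction (sym i≡) (Fin.punchInᵢ≢i i j)
  ... | no i≢ = cong (λ k → l k * a) (Fin.punchOut-punchIn i)

  l′≢0 : l′ (punchIn i j) ≢ 0ℚ
  l′≢0 eq = proj₂ (proj₁ (proj₂ eliminated)) (p*q≡0∧q≢0⇒p≡0 (l j) (trans (sym (l′-punchIn j)) eq) vᵢ≢0)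

  split : ∀ e → sumF (λ k → l′ k * v k e) ≡ - s * v i e + sumF (λ j → l j * a * u j e)
  split e = trans (sumF-remove i (λ k → l′ k * v k e))
    (cong₂ _+_ (cong (_* v i e) l′-pivot) (sumF-cong λ j → cong (_* u j e) (l′-punchIn j)))

  relation : ∀ e → sumF (λ k → l′ k * v k e) ≡ 0ℚ
  relation zero = begin
    sumF (λ k → l′ k * v k zero)                     ≡⟨ split zero ⟩
    - s * a + sumF (λ j → l j * a * u j zero)        ≡⟨ cong (- s * a +_) (sumF-cong λ j → xyz≡xzy (l j) a (u j zero)) ⟩
    - s * a + sumF (λ j → l j * u j zero * a)        ≡⟨ cong (- s * a +_) (*-distribʳ-sumF a (λ j → l j * u j zero)) ⟨
    - s * a + s * a                                  ≡⟨ -xy+xy≡0 s a ⟩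
    0ℚ                                               ∎
    where
    open ≡-Reasoning
    xyz≡xzy : ∀ x y z → x * y * z ≡ x * z * y
    xyz≡xzy = solve-∀ ℚ-ring
    -xy+xy≡0 : ∀ x y → - x * y + x * y ≡ 0ℚ
    -xy+xy≡0 = solve-∀ ℚ-ring
  relation (suc e) = begin
    sumF (λ k → l′ k * v k (suc e))
      ≡⟨ split (suc e) ⟩
    - s * b + sumF (λ j → l j * a * u j (suc e))
      ≡⟨ cong (- s * b +_) (sumF-cong λ j → expand (l j) a (u j (suc e)) (u j zero) b) ⟩
    - s * b + sumF (λ j → l j * (a * u j (suc e) -ℚ u j zero * b) + l j * u j zero * b)
      ≡⟨ cong (- s * b +_) (sumF-distrib-+ (λ j → l j * (a * u j (suc e) -ℚ u j zero * b)) (λ j → l j * u j zero * b)) ⟩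
    - s * b + (sumF (λ j → l j * (a * u j (suc e) -ℚ u j zero * b)) + sumF (λ j → l j * u j zero * b))
      ≡⟨ cong₂ (λ x y → - s * b + (x + y)) (proj₂ (proj₂ eliminated) e) (sym (*-distribʳ-sumF b (λ j → l j * u j zero))) ⟩
    - s * b + (0ℚ + s * b)
      ≡⟨ cancel s b ⟩
    0ℚ ∎
    where
    open ≡-Reasoning
    b = v i (suc e)
    expand : ∀ l a x y b → l * a * x ≡ l * (a * x -ℚ y * b) + l * y * b
    expand = solve-∀ ℚ-ring
    cancel : ∀ x y → - x * y + (0ℚ + x * y) ≡ 0ℚ
    cancel = solve-∀ ℚ-ring

-- Linear functionals and affine dependence

dot-combination : ∀ {m} w (l : Fin m → ℚ) (p : Fin m → Point) →
  dot w (λ e → sumF (λ i → l i * p i e)) ≡ sumF (λ i → l i * dot w (p i))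
dot-combination w l p = begin
  sumF (λ e → w e * sumF (λ i → l i * p i e))
    ≡⟨ sumF-cong (λ e → *-distribˡ-sumF (w e) (λ i → l i * p i e)) ⟩
  sumF (λ e → sumF (λ i → w e * (l i * p i e)))
    ≡⟨ sumF-comm (λ e i → w e * (l i * p i e)) ⟩
  sumF (λ i → sumF (λ e → w e * (l i * p i e)))
    ≡⟨ sumF-cong (λ i → sumF-cong λ e → x[yz]≡y[xz] (w e) (l i) (p i e)) ⟩
  sumF (λ i → sumF (λ e → l i * (w e * p i e)))
    ≡⟨ sumF-cong (λ i → *-distribˡ-sumF (l i) (λ e → w e * p i e)) ⟨
  sumF (λ i → l i * dot w (p i)) ∎
  where
  open ≡-Reasoning
  x[yz]≡y[xz] : ∀ x y z → x * (y * z) ≡ y * (x * z)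
  x[yz]≡y[xz] = solve-∀ ℚ-ring

dot-combination-const : ∀ {m} w {c} (l : Fin m → ℚ) (p : Fin m → Point) → (∀ i → dot w (p i) ≡ c) →
  dot w (λ e → sumF (λ i → l i * p i e)) ≡ sumF l * c
dot-combination-const w {c} l p const =
  trans (dot-combination w l p) (trans (sumF-cong λ i → cong (l i *_) (const i)) (sym (*-distribʳ-sumF c l)))

dot-congʳ : ∀ w {x y : Point} → (∀ e → x e ≡ y e) → dot w x ≡ dot w y
dot-congʳ w {x} {y} x≗y = sumF-cong {f = λ e → w e * x e} {λ e → w e * y e} λ e → cong (w e *_) (x≗y e)

dot-zeroʳ : ∀ w {x : Point} → (∀ e → x e ≡ 0ℚ) → dot w x ≡ 0ℚ
dot-zeroʳ w {x} x≗0 = sumF-zero {f = λ e → w e * x e} λ e → trans (cong (w e *_) (x≗0 e)) (ℚ.*-zeroʳ (w e))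

-- The affine functional `dot (w i) x - k i` vanishes at every point except the i-th. Applied to an
-- affine relation it leaves only `l i` times a nonzero number; the constant drops out because the
-- coefficients sum to 0.
separated⇒affinelyIndependent : ∀ {m} (p w : Fin m → Point) (k : Fin m → ℚ) →
  (∀ i j → i ≢ j → dot (w i) (p j) ≡ k i) → (∀ i → dot (w i) (p i) ≢ k i) → AffinelyIndependent p
separated⇒affinelyIndependent {suc m} p w k off diag l Σl≡0 relation i =
  p*q≡0∧q≢0⇒p≡0 (l i) l*δ≡0 (λ d≡k → diag i (x-y≡0⇒x≡y _ _ d≡k))
  where
  open ≡-Reasoning
  x-y≡0⇒x≡y : ∀ x y → x -ℚ y ≡ 0ℚ → x ≡ y
  x-y≡0⇒x≡y x y eq = trans (x≡[x-y]+y x y) (trans (cong (_+ y) eq) (ℚ.+-identityˡ y))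
    where
    x≡[x-y]+y : ∀ x y → x ≡ (x -ℚ y) + y
    x≡[x-y]+y = solve-∀ ℚ-ring
  d : Fin (suc m) → ℚ
  d j = dot (w i) (p j)
  x[y-z] : ∀ x y z → x * (y -ℚ z) ≡ x * y + x * - z
  x[y-z] = solve-∀ ℚ-ring
  l*δ≡0 : l i * (d i -ℚ k i) ≡ 0ℚ
  l*δ≡0 = begin
    l i * (d i -ℚ k i)
      ≡⟨ ℚ.+-identityʳ _ ⟨
    l i * (d i -ℚ k i) + 0ℚ
      ≡⟨ cong (l i * (d i -ℚ k i) +_) (sumF-zero λ j → let j′ = punchIn i j in
           trans (cong (λ x → l j′ * (x -ℚ k i)) (off i j′ (Fin.punchInᵢ≢i i j ∘ sym)))
             (trans (cong (l j′ *_) (ℚ.+-inverseʳ (k i))) (ℚ.*-zeroʳ (l j′)))) ⟨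
    l i * (d i -ℚ k i) + sumF (λ j → l (punchIn i j) * (d (punchIn i j) -ℚ k i))
      ≡⟨ sumF-remove i (λ j → l j * (d j -ℚ k i)) ⟨
    sumF (λ j → l j * (d j -ℚ k i))
      ≡⟨ sumF-cong (λ j → x[y-z] (l j) (d j) (k i)) ⟩
    sumF (λ j → l j * d j + l j * - k i)
      ≡⟨ sumF-distrib-+ (λ j → l j * d j) (λ j → l j * - k i) ⟩
    sumF (λ j → l j * d j) + sumF (λ j → l j * - k i)
      ≡⟨ cong₂ _+_ (dot-combination (w i) l p) (*-distribʳ-sumF (- k i) l) ⟨
    dot (w i) (λ e → sumF (λ j → l j * p j e)) + sumF l * - k i
      ≡⟨ cong₂ _+_ (dot-zeroʳ (w i) relation) (cong (_* - k i) Σl≡0) ⟩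
    0ℚ + 0ℚ * - k i
      ≡⟨ trans (ℚ.+-identityˡ (0ℚ * - k i)) (ℚ.*-zeroˡ (- k i)) ⟩
    0ℚ ∎

affinelyIndependent-tail : ∀ {m} (p : Fin (suc m) → Point) → AffinelyIndependent p → AffinelyIndependent (p ∘ suc)
affinelyIndependent-tail {m} p indep l Σl≡0 relation i =
  indep l′ (trans (ℚ.+-identityˡ _) Σl≡0)
    (λ e → trans (cong₂ _+_ (ℚ.*-zeroˡ (p zero e)) (relation e)) (ℚ.+-identityˡ 0ℚ)) (suc i)
  where
  l′ : Fin (suc m) → ℚ
  l′ zero = 0ℚ
  l′ (suc i) = l i

-- Twelve vectors in dimension 11 have a linear relation. Applying `w` to it gives
-- `sumF l * c ≡ 0ℚ`, so the relation is already affine.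
hyperplane-affinelyDependent : ∀ w {c} → c ≢ 0ℚ → (p : Fin 12 → Point) → (∀ i → dot w (p i) ≡ c) → ¬ AffinelyIndependent p
hyperplane-affinelyDependent w {c} c≢0 p p∈ indep =
  let l , (i , lᵢ≢0) , relation = linearlyDependent 11 p
      Σl*c≡0 = trans (sym (dot-combination-const w l p p∈)) (dot-zeroʳ w relation)
  in lᵢ≢0 (indep l (p*q≡0∧q≢0⇒p≡0 (sumF l) Σl*c≡0 c≢0) relation i)

-- A relation between the last ten coordinates extends to the first one: w, which ignores
-- the first coordinate, gives Σ l ≡ 0, and then w′ determines the first coordinate.
codim2-affinelyDependent : ∀ w w′ {c c′} → w zero ≡ 0ℚ → w′ zero ≢ 0ℚ → c ≢ 0ℚ → (p : Fin 11 → Point) →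
  (∀ i → dot w (p i) ≡ c) → (∀ i → dot w′ (p i) ≡ c′) → ¬ AffinelyIndependent p
codim2-affinelyDependent w w′ {c} {c′} w₀≡0 w′₀≢0 c≢0 p p∈ p∈′ indep =
  lᵢ≢0 (indep l Σl≡0 (λ { zero → x₀≡0 ; (suc e) → relation e }) i)
  where
  dependent = linearlyDependent 10 (λ i → p i ∘ suc)
  l = proj₁ dependent
  i = proj₁ (proj₁ (proj₂ dependent))
  lᵢ≢0 = proj₂ (proj₁ (proj₂ dependent))
  relation = proj₂ (proj₂ dependent)

  x : Point
  x e = sumF (λ i → l i * p i e)

  dot-head : ∀ w → dot w x ≡ x zero * w zero
  dot-head w = begin
    w zero * x zero + sumF tail ≡⟨ cong (w zero * x zero +_) (sumF-zero {f = tail} λ e →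
                                     trans (cong (w (suc e) *_) (relation e)) (ℚ.*-zeroʳ (w (suc e)))) ⟩
    w zero * x zero + 0ℚ        ≡⟨ ℚ.+-identityʳ (w zero * x zero) ⟩
    w zero * x zero             ≡⟨ ℚ.*-comm (w zero) (x zero) ⟩
    x zero * w zero             ∎
    where
    open ≡-Reasoning
    tail : Fin 10 → ℚ
    tail e = w (suc e) * x (suc e)

  Σl≡0 : sumF l ≡ 0ℚ
  Σl≡0 = p*q≡0∧q≢0⇒p≡0 (sumF l)
    (trans (sym (dot-combination-const w l p p∈))
      (trans (dot-head w) (trans (cong (x zero *_) w₀≡0) (ℚ.*-zeroʳ (x zero))))) c≢0

  x₀≡0 : x zero ≡ 0ℚ
  x₀≡0 = p*q≡0∧q≢0⇒p≡0 (x zero)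
    (trans (sym (dot-head w′))
      (trans (dot-combination-const w′ l p p∈′) (trans (cong (_* c′) Σl≡0) (ℚ.*-zeroˡ c′)))) w′₀≢0

-- Incidence vectors and inequalities on base polytopes

indicator : Bool → ℚ
indicator b = if b then 1ℚ else 0ℚ

-- Stated for every n to allow induction, as `χ` and `dot` are tied to 11 elements. The multiple of
-- `1ℚ` grows by one summand with each common element.
sumF-indicator : ∀ {n} (p q : Subset n) →
  sumF (λ e → indicator (lookup q e) * indicator (lookup p e)) ≡ ∣ p ∩ q ∣ ×ℚ 1ℚ
sumF-indicator [] [] = refl
sumF-indicator (inside ∷ p) (inside ∷ q) = cong (1ℚ +_) (sumF-indicator p q)
sumF-indicator (inside ∷ p) (outside ∷ q) = trans (cong (0ℚ +_) (sumF-indicator p q)) (ℚ.+-identityˡ _)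
sumF-indicator (outside ∷ p) (inside ∷ q) = trans (cong (0ℚ +_) (sumF-indicator p q)) (ℚ.+-identityˡ _)
sumF-indicator (outside ∷ p) (outside ∷ q) = trans (cong (0ℚ +_) (sumF-indicator p q)) (ℚ.+-identityˡ _)

dot-χ : ∀ F B → dot (χ F) (χ B) ≡ ∣ B ∩ F ∣ ×ℚ 1ℚ
dot-χ F B = sumF-indicator B F

χ∈BasePolytope : ∀ (𝓑 : Family) B → 𝓑 B → BasePolytope 𝓑 (χ B)
χ∈BasePolytope 𝓑 B hB = 1 , (λ _ → 1ℚ) , (λ _ → B) , (λ _ → hB) , (λ _ → from-yes (0ℚ ℚ.≤? 1ℚ)) , refl ,
  λ e → sym (trans (ℚ.+-identityʳ _) (ℚ.*-identityˡ (χ B e)))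

-- A linear equation that holds at the vertices passes to their convex hull. This supplies the
-- hyperplanes that bound the dimensions from above.
∣B∩F∣≡k⇒dot≡k : ∀ 𝓑 F {k} → (∀ B → 𝓑 B → ∣ B ∩ F ∣ ≡ k) → ∀ {x} → BasePolytope 𝓑 x → dot (χ F) x ≡ k ×ℚ 1ℚ
∣B∩F∣≡k⇒dot≡k 𝓑 F {k} size {x} (m , c , Bs , hBs , _ , Σc≡1 , x≗) = begin
  dot (χ F) x        ≡⟨ dot-congʳ (χ F) {x} {combination} x≗ ⟩
  dot (χ F) combination ≡⟨ dot-combination-const (χ F) c (χ ∘ Bs)
    (λ i → trans (dot-χ F (Bs i)) (cong (_×ℚ 1ℚ) (size (Bs i) (hBs i)))) ⟩
  sumF c * k ×ℚ 1ℚ   ≡⟨ cong (_* k ×ℚ 1ℚ) Σc≡1 ⟩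
  1ℚ * k ×ℚ 1ℚ       ≡⟨ ℚ.*-identityˡ _ ⟩
  k ×ℚ 1ℚ            ∎
  where
  open ≡-Reasoning
  combination : Point
  combination e = sumF (λ i → c i * χ (Bs i) e)

-- The same for an inequality; it serves to keep a vertex of B(M₁) out of B(M₂).
∣B∩F∣≤1⇒dot≤1 : ∀ 𝓑 F → (∀ B → 𝓑 B → ∣ B ∩ F ∣ ℕ.≤ 1) → ∀ {x} → BasePolytope 𝓑 x → dot (χ F) x ≤ 1ℚ
∣B∩F∣≤1⇒dot≤1 𝓑 F size {x} (m , c , Bs , hBs , c≥0 , Σc≡1 , x≗) = begin
  dot (χ F) x                            ≡⟨ dot-congʳ (χ F) {x} {combination} x≗ ⟩
  dot (χ F) combination                  ≡⟨ dot-combination (χ F) c (χ ∘ Bs) ⟩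
  sumF (λ i → c i * dot (χ F) (χ (Bs i))) ≤⟨ sumF-mono-≤ (λ i →
    ℚ.*-monoˡ-≤-nonNeg (c i) {{nonNegative (c≥0 i)}} (dot≤1 (Bs i) (size (Bs i) (hBs i)))) ⟩
  sumF (λ i → c i * 1ℚ)                  ≡⟨ sumF-cong (λ i → ℚ.*-identityʳ (c i)) ⟩
  sumF c                                 ≡⟨ Σc≡1 ⟩
  1ℚ                                     ∎
  where
  open ℚ.≤-Reasoning
  combination : Point
  combination e = sumF (λ i → c i * χ (Bs i) e)

  n≤1⇒n×1≤1 : ∀ {n} → n ℕ.≤ 1 → n ×ℚ 1ℚ ≤ 1ℚ
  n≤1⇒n×1≤1 {0} _ = from-yes (0ℚ ℚ.≤? 1ℚ)
  n≤1⇒n×1≤1 {1} _ = ℚ.≤-refl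
  n≤1⇒n×1≤1 {suc (suc n)} (ℕ.s≤s ())

  dot≤1 : ∀ B → ∣ B ∩ F ∣ ℕ.≤ 1 → dot (χ F) (χ B) ≤ 1ℚ
  dot≤1 B ≤1 = ℚ.≤-trans (ℚ.≤-reflexive (dot-χ F B)) (n≤1⇒n×1≤1 ≤1)

-- The two base polytopes

abcd efgh efghijk : Subset 11
abcd = set (𝕒 ∷ 𝕓 ∷ 𝕔 ∷ 𝕕 ∷ [])
efgh = set (𝕖 ∷ 𝕗 ∷ 𝕘 ∷ 𝕙 ∷ [])
efghijk = set (𝕖 ∷ 𝕗 ∷ 𝕘 ∷ 𝕙 ∷ 𝕚 ∷ 𝕛 ∷ 𝕜 ∷ [])

-- The separator of index i meets all vertices in the same number of elements, except the i-th.
vertex separator : Fin 11 → Subset 11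
vertex = Vec.lookup
  (set (𝕖 ∷ 𝕚 ∷ 𝕛 ∷ []) ∷
   set (𝕒 ∷ 𝕖 ∷ 𝕚 ∷ []) ∷ set (𝕓 ∷ 𝕖 ∷ 𝕚 ∷ []) ∷ set (𝕔 ∷ 𝕖 ∷ 𝕚 ∷ []) ∷ set (𝕕 ∷ 𝕖 ∷ 𝕚 ∷ []) ∷
   set (𝕒 ∷ 𝕗 ∷ 𝕚 ∷ []) ∷ set (𝕒 ∷ 𝕘 ∷ 𝕚 ∷ []) ∷ set (𝕒 ∷ 𝕙 ∷ 𝕚 ∷ []) ∷
   set (𝕒 ∷ 𝕖 ∷ 𝕛 ∷ []) ∷ set (𝕒 ∷ 𝕖 ∷ 𝕜 ∷ []) ∷ set (𝕒 ∷ 𝕚 ∷ 𝕜 ∷ []) ∷ [])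
separator = Vec.lookup
  (abcd ∷
   set (𝕒 ∷ 𝕖 ∷ 𝕚 ∷ []) ∷ ⁅ 𝕓 ⁆ ∷ ⁅ 𝕔 ⁆ ∷ ⁅ 𝕕 ⁆ ∷
   ⁅ 𝕗 ⁆ ∷ ⁅ 𝕘 ⁆ ∷ ⁅ 𝕙 ⁆ ∷
   set (𝕒 ∷ 𝕓 ∷ 𝕔 ∷ 𝕕 ∷ 𝕛 ∷ []) ∷ set (𝕖 ∷ 𝕗 ∷ 𝕘 ∷ 𝕙 ∷ 𝕜 ∷ []) ∷ efgh ∷ [])

commonSize : Fin 11 → ℕ
commonSize = Vec.lookup (1 ∷ 2 ∷ 0 ∷ 0 ∷ 0 ∷ 0 ∷ 0 ∷ 0 ∷ 1 ∷ 1 ∷ 1 ∷ [])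

vertices-affinelyIndependent : AffinelyIndependent (χ ∘ vertex)
vertices-affinelyIndependent = separated⇒affinelyIndependent (χ ∘ vertex) (χ ∘ separator) (λ i → commonSize i ×ℚ 1ℚ)
  (λ i j i≢j → trans (dot-χ (separator i) (vertex j))
    -- Decided for all pairs at once and then instantiated, since `from-yes` needs a closed
    -- proposition to compute.
    (cong (_×ℚ 1ℚ) (from-yes (Fin.all? λ i → Fin.all? λ j → ¬? (i Fin.≟ j) →-dec
      (∣ vertex j ∩ separator i ∣ ℕ.≟ commonSize i)) i j i≢j)))
  (λ i eq → from-yes (Fin.all? λ i → ¬? ((∣ vertex i ∩ separator i ∣ ×ℚ 1ℚ) ℚ.≟ (commonSize i ×ℚ 1ℚ))) i
    (trans (sym (dot-χ (separator i) (vertex i))) eq))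

dim₁ : HasDim (BasePolytope 𝓑₁) 10
dim₁ =
  (χ ∘ vertex , (λ i → χ∈BasePolytope 𝓑₁ (vertex i) (from-yes (Fin.all? (𝓑₁? ∘ vertex)) i)) , vertices-affinelyIndependent) ,
  λ p p∈ → hyperplane-affinelyDependent (χ ⊤) {3 ×ℚ 1ℚ} (λ ()) p
    λ i → ∣B∩F∣≡k⇒dot≡k 𝓑₁ ⊤ (λ B hB → trans (cong ∣_∣ (∩-identityʳ B)) (proj₁ hB)) (p∈ i)

-- All vertices in the list but the first, eij, are bases of M₂. From above, |B ∩ efghijk| = 2 does
-- not involve a while |B ∩ abcd| = 1 does, as `codim2-affinelyDependent` requires.
dim₂ : HasDim (BasePolytope 𝓑₂) 9
dim₂ =
  (χ ∘ vertex ∘ suc , (λ i → χ∈BasePolytope 𝓑₂ (vertex (suc i)) (from-yes (Fin.all? (𝓑₂? ∘ vertex ∘ suc)) i)) ,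
    affinelyIndependent-tail (χ ∘ vertex) vertices-affinelyIndependent) ,
  λ p p∈ → codim2-affinelyDependent (χ efghijk) (χ abcd) {2 ×ℚ 1ℚ} {1 ×ℚ 1ℚ} refl (λ ()) (λ ()) p
    (λ i → ∣B∩F∣≡k⇒dot≡k 𝓑₂ efghijk (λ B → proj₂ ∘ sizes B) (p∈ i))
    (λ i → ∣B∩F∣≡k⇒dot≡k 𝓑₂ abcd (λ B → proj₁ ∘ sizes B) (p∈ i))
  where
  sizes : ∀ B → 𝓑₂ B → ∣ B ∩ abcd ∣ ≡ 1 × ∣ B ∩ efghijk ∣ ≡ 2
  sizes B hB = from-yes (allOfSize? 11 3 λ B → 𝓑₂? B →-dec
    ((∣ B ∩ abcd ∣ ℕ.≟ 1) ×-dec (∣ B ∩ efghijk ∣ ℕ.≟ 2))) B (proj₁ hB) hB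

-- χ aef = χ aei + χ afk - χ aik lies on every hyperplane containing the base polytope of M₂.
not-face : ¬ IsFace (BasePolytope 𝓑₂) (BasePolytope 𝓑₁)
not-face (w , c , _ , F⊆ , ⊆F) =
  -- aef contains both e and f, so the functional takes the value 2 there, against the bound 1 on
  -- B(M₂).
  from-no (dot (χ efgh) (χ aef) ℚ.≤? 1ℚ)
    (∣B∩F∣≤1⇒dot≤1 𝓑₂ efgh (λ B hB → proj₁ (proj₂ (proj₂ hB)))
      (⊆F (χ aef) (χ∈BasePolytope 𝓑₁ aef (from-yes (𝓑₁? aef))) dot-aef))
  where
  aef : Subset 11
  aef = set (𝕒 ∷ 𝕖 ∷ 𝕗 ∷ [])

  bases : Fin 3 → Subset 11
  bases = Vec.lookup (set (𝕒 ∷ 𝕖 ∷ 𝕚 ∷ []) ∷ set (𝕒 ∷ 𝕗 ∷ 𝕜 ∷ []) ∷ set (𝕒 ∷ 𝕚 ∷ 𝕜 ∷ []) ∷ [])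

  coefficient : Fin 3 → ℚ
  coefficient = Vec.lookup (1ℚ ∷ 1ℚ ∷ - 1ℚ ∷ [])

  dot-aef : dot w (χ aef) ≡ c
  dot-aef = begin
    dot w (χ aef)
      ≡⟨ dot-congʳ w (from-yes (Fin.all? λ e → χ aef e ℚ.≟ sumF (λ i → coefficient i * χ (bases i) e))) ⟩
    dot w (λ e → sumF (λ i → coefficient i * χ (bases i) e))
      ≡⟨ dot-combination-const w coefficient (χ ∘ bases)
           (λ i → proj₂ (F⊆ (χ (bases i)) (χ∈BasePolytope 𝓑₂ (bases i) (from-yes (Fin.all? (𝓑₂? ∘ bases)) i)))) ⟩
    -- The coefficients 1, 1, -1 sum to 1, and the functional has the value c at all three bases of
    -- M₂.
    1ℚ * c
      ≡⟨ ℚ.*-identityˡ c ⟩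
    c ∎
    where open ≡-Reasoning

theorem5p12 : IsMatroidBases 𝓑₁ 3 × IsMatroidBases 𝓑₂ 3 ×
    (𝓑₂ ⊆ᶠ 𝓑₁) ×
    Covers 3 𝓑₁ 𝓑₂ ×
    (∃[ d₁ ] ∃[ d₂ ] (HasDim (BasePolytope 𝓑₁) d₁ × HasDim (BasePolytope 𝓑₂) d₂ × d₂ < d₁)) ×
    ¬ IsFacet (BasePolytope 𝓑₂) (BasePolytope 𝓑₁)
theorem5p12 =
  isMatroid₁ , isMatroid₂ , 𝓑₂⊆𝓑₁ , 𝓑₁-covers-𝓑₂ ,
  (10 , 9 , dim₁ , dim₂ , ℕ.n<1+n 9) , not-face ∘ proj₁
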